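{- Let $\mathscr D$ be a duploid, $\mathscr C$ an (associative) category, and let $F:\mathscr C\rightharpoonup\mathscr D$, $G:\mathscr D\rightharpoonup\mathscr C$ form a positive adjunction ($F$ left adjoint, $G$ right adjoint). Then it induces a $\Downarrow$-relative coadjunction for the functor $\Downarrow:\mathscr N_l\to\mathscr P_t$: the functors $F:\mathscr C\to\mathscr P_t$ and $G:\mathscr N_l\to\mathscr C$ obtained by corestriction of $F$ and restriction of $G$ come with bijections $$\mathscr P_t(FC,\Downarrow N)\;\cong\;\mathscr C(C,GN)$$ natural in $C\in\mathscr C$ and $N\in\mathscr N_l$.
   Context: A non-associative category is a category without the associativity axiom. A bare functor $\mathscr D\rightharpoonup\mathscr E$ is a morphism of reflexive graphs (preserves identities but not necessarily composition). A morphism $f$ is thunkable if $(h\circ g)\circ f=h\circ(g\circ f)$ for all composable $g,h$; $h$ is linear if $(h\circ g)\circ f=h\circ(g\circ f)$ for all composable $f,g$. An object $A$ is positive if every morphism with source $A$ is linear, negative if every morphism with target $A$ is thunkable. An adjunction over non-associative categories $\mathscr D,\mathscr E$ consists of bare functors $F:\mathscr D\rightharpoonup\mathscr E$, $G:\mathscr E\rightharpoonup\mathscr D$ and bijections $\varphi_{A,B}:\mathscr E(FA,B)\cong\mathscr D(A,GB)$ with $\varphi(g\circ h)=Gg\circ\varphi(h)$ and $\varphi(h\circ Ff)=\varphi(h)\circ f$ for all composable $g,h,f$. It is positive when every $FA$ is positive, negative when every $GB$ is negative. A duploid is a non-associative category $\mathscr D$ in which every object is positive or negative (or both), and in which the identity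 functor $\mathscr D\to\mathscr D$ has a left adjoint $\Downarrow:\mathscr D\rightharpoonup\mathscr D$ with positive values and a right adjoint $\Uparrow:\mathscr D\rightharpoonup\mathscr D$ with negative values. $\mathscr P_t$ is the category of positive objects and thunkable morphisms of $\mathscr D$; $\mathscr N_l$ is the category of negative objects and linear morphisms of $\mathscr D$. $\Downarrow$ restricts to a functor $\mathscr N_l\to\mathscr P_t$, right adjoint to the restriction $\Uparrow:\mathscr P_t\to\mathscr N_l$. It is known that right adjoints preserve linear maps and their composition, and left adjoints preserve thunkable maps and their composition, and that the left adjoint of a positive adjunction from a category $\mathscr C$ is a functor that corestricts to $\mathscr C\to\mathscr P_t$. For a functor $R:\mathscr B\to\mathscr A$ between categories, an $R$-relative coadjunction consists of a category $\mathscr C$, functors $F:\mathscr C\to\mathscr A$, $G:\mathscr B\to\mathscr C$, and bijections $\mathscr A(FC,RB)\cong\mathscr C(C,GB)$ natural in $B$ and $C$. -}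

module Defs where

open import Data.Product using (Σ; _,_; proj₁; proj₂)
open import Data.Sum using (_⊎_)
open import Function.Bundles using (Injection; Inverse)
open import Function.Properties.Inverse using (Inverse⇒Injection)
open import Level using (Level; _⊔_; suc)
open import Relation.Binary.Bundles using (Setoid)
open import Relation.Binary.Structures using (IsEquivalence)
import Relation.Binary.Reasoning.Setoid as SetoidReasoning

private
  variable
    o ℓ e o′ ℓ′ e′ o″ ℓ″ e″ : Level

-- Homs are setoids, so that thunkable (or linear) morphisms, which carry a
-- proof, can be compared by their underlying morphisms alone.
record NonAssocCategory (o ℓ e : Level) : Set (suc (o ⊔ ℓ ⊔ e)) where
  infix  4 _≈_ _⇒_
  infixr 9 _∘_
  field
    Obj : Set o
    _⇒_ : Obj → Obj → Set ℓ
    _≈_ : ∀ {A B} → A ⇒ B → A ⇒ B → Set e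
    id  : ∀ {A} → A ⇒ A
    _∘_ : ∀ {A B C} → B ⇒ C → A ⇒ B → A ⇒ C

    isEquivalence : ∀ {A B} → IsEquivalence (_≈_ {A} {B})
    ∘-cong    : ∀ {A B C} {g g′ : B ⇒ C} {f f′ : A ⇒ B} →
                g ≈ g′ → f ≈ f′ → g ∘ f ≈ g′ ∘ f′
    identityˡ : ∀ {A B} (f : A ⇒ B) → id ∘ f ≈ f
    identityʳ : ∀ {A B} (f : A ⇒ B) → f ∘ id ≈ f

  hom : Obj → Obj → Setoid ℓ e
  hom A B = record
    { Carrier       = A ⇒ B
    ; _≈_           = _≈_
    ; isEquivalence = isEquivalence
    }

  module ≈ {A B : Obj} = IsEquivalence (isEquivalence {A} {B})

  ∘-congˡ : ∀ {A B C} {g : B ⇒ C} {f f′ : A ⇒ B} → f ≈ f′ → g ∘ f ≈ g ∘ f′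
  ∘-congˡ = ∘-cong ≈.refl

  ∘-congʳ : ∀ {A B C} {g g′ : B ⇒ C} {f : A ⇒ B} → g ≈ g′ → g ∘ f ≈ g′ ∘ f
  ∘-congʳ p = ∘-cong p ≈.refl

  Thunkable : ∀ {A B} → A ⇒ B → Set (o ⊔ ℓ ⊔ e)
  Thunkable {A} {B} f =
    ∀ {X Y} (g : B ⇒ X) (h : X ⇒ Y) → (h ∘ g) ∘ f ≈ h ∘ (g ∘ f)

  Linear : ∀ {A B} → A ⇒ B → Set (o ⊔ ℓ ⊔ e)
  Linear {A} {B} h =
    ∀ {X Y} (f : X ⇒ Y) (g : Y ⇒ A) → (h ∘ g) ∘ f ≈ h ∘ (g ∘ f)

  Positive : Obj → Set (o ⊔ ℓ ⊔ e)
  Positive A = ∀ {B} (h : A ⇒ B) → Linear h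

  Negative : Obj → Set (o ⊔ ℓ ⊔ e)
  Negative B = ∀ {A} (f : A ⇒ B) → Thunkable f

  thunkable-id : ∀ {A} → Thunkable (id {A})
  thunkable-id g h = ≈.trans (identityʳ _) (∘-congˡ (≈.sym (identityʳ g)))

  thunkable-∘ : ∀ {A B C} {g : B ⇒ C} {f : A ⇒ B} →
                Thunkable g → Thunkable f → Thunkable (g ∘ f)
  thunkable-∘ {A} {g = g} {f} g-th f-th {Y = Y} k h = begin
    (h ∘ k) ∘ (g ∘ f)  ≈⟨ f-th g (h ∘ k) ⟨
    ((h ∘ k) ∘ g) ∘ f  ≈⟨ ∘-congʳ (g-th k h) ⟩
    (h ∘ (k ∘ g)) ∘ f  ≈⟨ f-th (k ∘ g) h ⟩
    h ∘ ((k ∘ g) ∘ f)  ≈⟨ ∘-congˡ (f-th g k) ⟩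
    h ∘ (k ∘ (g ∘ f))  ∎
    where open SetoidReasoning (hom A Y)

  linear-id : ∀ {A} → Linear (id {A})
  linear-id f g = ≈.trans (∘-congʳ (identityˡ g)) (≈.sym (identityˡ _))

  linear-∘ : ∀ {A B C} {k : B ⇒ C} {h : A ⇒ B} →
             Linear k → Linear h → Linear (k ∘ h)
  linear-∘ {C = C} {k = k} {h} k-lin h-lin {X = X} f g = begin
    ((k ∘ h) ∘ g) ∘ f  ≈⟨ ∘-congʳ (k-lin g h) ⟩
    (k ∘ (h ∘ g)) ∘ f  ≈⟨ k-lin f (h ∘ g) ⟩
    k ∘ ((h ∘ g) ∘ f)  ≈⟨ ∘-congˡ (h-lin f g) ⟩
    k ∘ (h ∘ (g ∘ f))  ≈⟨ k-lin (g ∘ f) h ⟨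
    (k ∘ h) ∘ (g ∘ f)  ∎
    where open SetoidReasoning (hom X C)

record Category (o ℓ e : Level) : Set (suc (o ⊔ ℓ ⊔ e)) where
  field
    nonAssocCategory : NonAssocCategory o ℓ e
  open NonAssocCategory nonAssocCategory public
  field
    assoc : ∀ {A B C D} (f : A ⇒ B) (g : B ⇒ C) (h : C ⇒ D) →
            (h ∘ g) ∘ f ≈ h ∘ (g ∘ f)

infix 3 _⇀_

record _⇀_ (𝒟 : NonAssocCategory o ℓ e) (ℰ : NonAssocCategory o′ ℓ′ e′)
           : Set (o ⊔ ℓ ⊔ e ⊔ o′ ⊔ ℓ′ ⊔ e′) where
  private
    module 𝒟 = NonAssocCategory 𝒟
    module ℰ = NonAssocCategory ℰ
  field
    F₀       : 𝒟.Obj → ℰ.Obj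
    F₁       : ∀ {A B} → A 𝒟.⇒ B → F₀ A ℰ.⇒ F₀ B
    F-cong   : ∀ {A B} {f g : A 𝒟.⇒ B} → f 𝒟.≈ g → F₁ f ℰ.≈ F₁ g
    identity : ∀ {A} → F₁ (𝒟.id {A}) ℰ.≈ ℰ.id

idBare : {𝒟 : NonAssocCategory o ℓ e} → 𝒟 ⇀ 𝒟
idBare {𝒟 = 𝒟} = record
  { F₀       = λ A → A
  ; F₁       = λ f → f
  ; F-cong   = λ p → p
  ; identity = NonAssocCategory.≈.refl 𝒟
  }

record Functor (𝒜 : Category o ℓ e) (ℬ : Category o′ ℓ′ e′)
               : Set (o ⊔ ℓ ⊔ e ⊔ o′ ⊔ ℓ′ ⊔ e′) where
  private
    module 𝒜 = Category 𝒜
    module ℬ = Category ℬ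
  field
    bareFunctor : 𝒜.nonAssocCategory ⇀ ℬ.nonAssocCategory
  open _⇀_ bareFunctor public
  field
    homomorphism : ∀ {A B C} (f : A 𝒜.⇒ B) (g : B 𝒜.⇒ C) →
                   F₁ (g 𝒜.∘ f) ℬ.≈ F₁ g ℬ.∘ F₁ f

infix 3 _⊣_

record _⊣_ {𝒟 : NonAssocCategory o ℓ e} {ℰ : NonAssocCategory o′ ℓ′ e′}
           (F : 𝒟 ⇀ ℰ) (G : ℰ ⇀ 𝒟) : Set (o ⊔ ℓ ⊔ e ⊔ o′ ⊔ ℓ′ ⊔ e′) where
  private
    module 𝒟 = NonAssocCategory 𝒟
    module ℰ = NonAssocCategory ℰ
    module F = _⇀_ F
    module G = _⇀_ G
  field
    φ : ∀ A B → Inverse (ℰ.hom (F.F₀ A) B) (𝒟.hom A (G.F₀ B))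

  ♯ : ∀ {A B} → F.F₀ A ℰ.⇒ B → A 𝒟.⇒ G.F₀ B
  ♯ = Inverse.to (φ _ _)

  field
    naturalʳ : ∀ {A B B′} (g : B ℰ.⇒ B′) (h : F.F₀ A ℰ.⇒ B) →
               ♯ (g ℰ.∘ h) 𝒟.≈ G.F₁ g 𝒟.∘ ♯ h
    naturalˡ : ∀ {A A′ B} (h : F.F₀ A ℰ.⇒ B) (f : A′ 𝒟.⇒ A) →
               ♯ (h ℰ.∘ F.F₁ f) 𝒟.≈ ♯ h 𝒟.∘ f

  ♯-cong : ∀ {A B} {h k : F.F₀ A ℰ.⇒ B} → h ℰ.≈ k → ♯ h 𝒟.≈ ♯ k
  ♯-cong = Inverse.to-cong (φ _ _)

  ♯-injective : ∀ {A B} {h k : F.F₀ A ℰ.⇒ B} → ♯ h 𝒟.≈ ♯ k → h ℰ.≈ k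
  ♯-injective = Injection.injective (Inverse⇒Injection (φ _ _))

  IsPositive : Set (o ⊔ o′ ⊔ ℓ′ ⊔ e′)
  IsPositive = ∀ A → ℰ.Positive (F.F₀ A)

  IsNegative : Set (o ⊔ ℓ ⊔ e ⊔ o′)
  IsNegative = ∀ B → 𝒟.Negative (G.F₀ B)

  F-thunkable : ∀ {A A′} {f : A 𝒟.⇒ A′} → 𝒟.Thunkable f → ℰ.Thunkable (F.F₁ f)
  F-thunkable {A} {f = f} f-th {Y = Y} g h = ♯-injective (begin
    ♯ ((h ℰ.∘ g) ℰ.∘ F.F₁ f)  ≈⟨ naturalˡ (h ℰ.∘ g) f ⟩
    ♯ (h ℰ.∘ g) 𝒟.∘ f         ≈⟨ 𝒟.∘-congʳ (naturalʳ h g) ⟩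
    (G.F₁ h 𝒟.∘ ♯ g) 𝒟.∘ f    ≈⟨ f-th (♯ g) (G.F₁ h) ⟩
    G.F₁ h 𝒟.∘ (♯ g 𝒟.∘ f)    ≈⟨ 𝒟.∘-congˡ (naturalˡ g f) ⟨
    G.F₁ h 𝒟.∘ ♯ (g ℰ.∘ F.F₁ f)  ≈⟨ naturalʳ h (g ℰ.∘ F.F₁ f) ⟨
    ♯ (h ℰ.∘ (g ℰ.∘ F.F₁ f))  ∎)
    where open SetoidReasoning (𝒟.hom A (G.F₀ Y))

  private
    ♯-F₁ : ∀ {A A′} (f : A 𝒟.⇒ A′) → ♯ (F.F₁ f) 𝒟.≈ ♯ ℰ.id 𝒟.∘ f
    ♯-F₁ f = 𝒟.≈.trans (♯-cong (ℰ.≈.sym (ℰ.identityˡ _))) (naturalˡ ℰ.id f)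

  F-homomorphism : ∀ {A B C} {f : A 𝒟.⇒ B} (g : B 𝒟.⇒ C) → 𝒟.Thunkable f →
                   F.F₁ (g 𝒟.∘ f) ℰ.≈ F.F₁ g ℰ.∘ F.F₁ f
  F-homomorphism {A} {C = C} {f = f} g f-th = ♯-injective (begin
    ♯ (F.F₁ (g 𝒟.∘ f))      ≈⟨ ♯-F₁ (g 𝒟.∘ f) ⟩
    ♯ ℰ.id 𝒟.∘ (g 𝒟.∘ f)    ≈⟨ f-th g (♯ ℰ.id) ⟨
    (♯ ℰ.id 𝒟.∘ g) 𝒟.∘ f    ≈⟨ 𝒟.∘-congʳ (♯-F₁ g) ⟨
    ♯ (F.F₁ g) 𝒟.∘ f        ≈⟨ naturalˡ (F.F₁ g) f ⟨
    ♯ (F.F₁ g ℰ.∘ F.F₁ f)   ∎)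
    where open SetoidReasoning (𝒟.hom A (G.F₀ (F.F₀ C)))

  private
    counit : ∀ {B} → F.F₀ (G.F₀ B) ℰ.⇒ B
    counit = Inverse.from (φ _ _) 𝒟.id

    ♯-counit : ∀ {B} → ♯ (counit {B}) 𝒟.≈ 𝒟.id
    ♯-counit = Inverse.strictlyInverseˡ (φ _ _) 𝒟.id

    ♯-∘-counit : ∀ {B C} (g : B ℰ.⇒ C) → ♯ (g ℰ.∘ counit) 𝒟.≈ G.F₁ g
    ♯-∘-counit {B} {C} g = begin
      ♯ (g ℰ.∘ counit)     ≈⟨ naturalʳ g counit ⟩
      G.F₁ g 𝒟.∘ ♯ counit  ≈⟨ 𝒟.∘-congˡ ♯-counit ⟩
      G.F₁ g 𝒟.∘ 𝒟.id      ≈⟨ 𝒟.identityʳ (G.F₁ g) ⟩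
      G.F₁ g               ∎
      where open SetoidReasoning (𝒟.hom (G.F₀ B) (G.F₀ C))

  G-homomorphism : ∀ {A B C} (f : A ℰ.⇒ B) {g : B ℰ.⇒ C} → ℰ.Linear g →
                   G.F₁ (g ℰ.∘ f) 𝒟.≈ G.F₁ g 𝒟.∘ G.F₁ f
  G-homomorphism {A} {C = C} f {g} g-lin = begin
    G.F₁ (g ℰ.∘ f)             ≈⟨ ♯-∘-counit (g ℰ.∘ f) ⟨
    ♯ ((g ℰ.∘ f) ℰ.∘ counit)   ≈⟨ ♯-cong (g-lin counit f) ⟩
    ♯ (g ℰ.∘ (f ℰ.∘ counit))   ≈⟨ naturalʳ g (f ℰ.∘ counit) ⟩
    G.F₁ g 𝒟.∘ ♯ (f ℰ.∘ counit)  ≈⟨ 𝒟.∘-congˡ (♯-∘-counit f) ⟩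
    G.F₁ g 𝒟.∘ G.F₁ f          ∎
    where open SetoidReasoning (𝒟.hom (G.F₀ A) (G.F₀ C))

record Duploid (o ℓ e : Level) : Set (suc (o ⊔ ℓ ⊔ e)) where
  field
    nonAssocCategory : NonAssocCategory o ℓ e
  open NonAssocCategory nonAssocCategory public
  field
    polarity   : ∀ A → Positive A ⊎ Negative A
    ⇓          : nonAssocCategory ⇀ nonAssocCategory
    ⇑          : nonAssocCategory ⇀ nonAssocCategory
    ⇓⊣id       : ⇓ ⊣ idBare
    ⇓-positive : _⊣_.IsPositive ⇓⊣id
    id⊣⇑       : idBare ⊣ ⇑
    ⇑-negative : _⊣_.IsNegative id⊣⇑

module _ (𝒟 : Duploid o ℓ e) where
  private
    module 𝒟 = Duploid 𝒟

  𝒫ₜ : Category (o ⊔ ℓ ⊔ e) (o ⊔ ℓ ⊔ e) e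
  𝒫ₜ = record
    { nonAssocCategory = record
      { Obj           = Σ 𝒟.Obj 𝒟.Positive
      ; _⇒_           = λ (P , _) (Q , _) → Σ (P 𝒟.⇒ Q) 𝒟.Thunkable
      ; _≈_           = λ (f , _) (g , _) → f 𝒟.≈ g
      ; id            = 𝒟.id , 𝒟.thunkable-id
      ; _∘_           = λ (g , g-th) (f , f-th) → g 𝒟.∘ f , 𝒟.thunkable-∘ g-th f-th
      ; isEquivalence = record
        { refl = 𝒟.≈.refl ; sym = 𝒟.≈.sym ; trans = 𝒟.≈.trans }
      ; ∘-cong        = 𝒟.∘-cong
      ; identityˡ     = λ (f , _) → 𝒟.identityˡ f
      ; identityʳ     = λ (f , _) → 𝒟.identityʳ f
      }
    ; assoc = λ (_ , f-th) (g , _) (h , _) → f-th g h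
    }

  𝒩ₗ : Category (o ⊔ ℓ ⊔ e) (o ⊔ ℓ ⊔ e) e
  𝒩ₗ = record
    { nonAssocCategory = record
      { Obj           = Σ 𝒟.Obj 𝒟.Negative
      ; _⇒_           = λ (N , _) (M , _) → Σ (N 𝒟.⇒ M) 𝒟.Linear
      ; _≈_           = λ (f , _) (g , _) → f 𝒟.≈ g
      ; id            = 𝒟.id , 𝒟.linear-id
      ; _∘_           = λ (g , g-lin) (f , f-lin) → g 𝒟.∘ f , 𝒟.linear-∘ g-lin f-lin
      ; isEquivalence = record
        { refl = 𝒟.≈.refl ; sym = 𝒟.≈.sym ; trans = 𝒟.≈.trans }
      ; ∘-cong        = 𝒟.∘-cong
      ; identityˡ     = λ (f , _) → 𝒟.identityˡ f
      ; identityʳ     = λ (f , _) → 𝒟.identityʳ f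
      }
    ; assoc = λ (f , _) (g , _) (_ , h-lin) → h-lin f g
    }

  -- A morphism of 𝒩ₗ is also thunkable, its target being negative; hence ⇓,
  -- a left adjoint, sends it to a thunkable morphism.
  ⇓ₗ : Functor 𝒩ₗ 𝒫ₜ
  ⇓ₗ = record
    { bareFunctor = record
      { F₀       = λ (N , _) → ⇓.F₀ N , 𝒟.⇓-positive N
      ; F₁       = λ {_} {(_ , M-neg)} (f , _) →
                     ⇓.F₁ f , ⇓⊣id.F-thunkable (M-neg f)
      ; F-cong   = ⇓.F-cong
      ; identity = ⇓.identity
      }
    ; homomorphism = λ {_} {(_ , M-neg)} (f , _) (g , _) →
                       ⇓⊣id.F-homomorphism g (M-neg f)
    }
    where
      module ⇓ = _⇀_ 𝒟.⇓
      module ⇓⊣id = _⊣_ 𝒟.⇓⊣id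

module _ (𝒟 : Duploid o ℓ e) (𝒞 : Category o′ ℓ′ e′)
         {F : Category.nonAssocCategory 𝒞 ⇀ Duploid.nonAssocCategory 𝒟}
         {G : Duploid.nonAssocCategory 𝒟 ⇀ Category.nonAssocCategory 𝒞}
         (F⊣G : F ⊣ G) where
  private
    module 𝒞 = Category 𝒞
    module F = _⇀_ F
    module G = _⇀_ G
    module F⊣G = _⊣_ F⊣G

  corestrictₜ : F⊣G.IsPositive → Functor 𝒞 (𝒫ₜ 𝒟)
  corestrictₜ F-pos = record
    { bareFunctor = record
      { F₀       = λ C → F.F₀ C , F-pos C
      ; F₁       = λ f → F.F₁ f , F⊣G.F-thunkable (𝒞.assoc f)
      ; F-cong   = F.F-cong
      ; identity = F.identity
      }
    ; homomorphism = λ f g → F⊣G.F-homomorphism g (𝒞.assoc f)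
    }

  restrictₗ : Functor (𝒩ₗ 𝒟) 𝒞
  restrictₗ = record
    { bareFunctor = record
      { F₀       = λ (N , _) → G.F₀ N
      ; F₁       = λ (f , _) → G.F₁ f
      ; F-cong   = G.F-cong
      ; identity = G.identity
      }
    ; homomorphism = λ (f , _) (_ , g-lin) → F⊣G.G-homomorphism f g-lin
    }

record RelativeCoadjunction
  {𝒜 : Category o ℓ e} {ℬ : Category o′ ℓ′ e′} {𝒞 : Category o″ ℓ″ e″}
  (R : Functor ℬ 𝒜) (F : Functor 𝒞 𝒜) (G : Functor ℬ 𝒞)
  : Set (o ⊔ ℓ ⊔ e ⊔ o′ ⊔ ℓ′ ⊔ e′ ⊔ o″ ⊔ ℓ″ ⊔ e″) where
  private
    module 𝒜 = Category 𝒜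
    module ℬ = Category ℬ
    module 𝒞 = Category 𝒞
    module R = Functor R
    module F = Functor F
    module G = Functor G
  field
    ψ : ∀ C B → Inverse (𝒜.hom (F.F₀ C) (R.F₀ B)) (𝒞.hom C (G.F₀ B))

  ♭ : ∀ {C B} → F.F₀ C 𝒜.⇒ R.F₀ B → C 𝒞.⇒ G.F₀ B
  ♭ = Inverse.to (ψ _ _)

  field
    naturalᴮ : ∀ {C B B′} (g : B ℬ.⇒ B′) (h : F.F₀ C 𝒜.⇒ R.F₀ B) →
               ♭ (R.F₁ g 𝒜.∘ h) 𝒞.≈ G.F₁ g 𝒞.∘ ♭ h
    naturalᶜ : ∀ {C C′ B} (h : F.F₀ C 𝒜.⇒ R.F₀ B) (f : C′ 𝒞.⇒ C) →
               ♭ (h 𝒜.∘ F.F₁ f) 𝒞.≈ ♭ h 𝒞.∘ f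

{-# OPTIONS --safe #-}

-- The adjunction ⇓ ⊣ id provides mutually inverse unwrap : ⇓ A → A and
-- wrap : A → ⇓ A, with unwrap linear and wrap thunkable.  Every morphism into
-- a negative N is thunkable, so composing with wrap and unwrap gives
-- 𝒟(A, N) ≅ {thunkable A → ⇓ N}, to be followed by 𝒟(F C, N) ≅ 𝒞(C, G N).
module Submission where

open import Defs
open import Data.Product using (_,_; proj₁)
open import Function.Bundles using (Inverse)
import Function.Construct.Composition as Composition
open import Level using (Level)
import Relation.Binary.Reasoning.Setoid as SetoidReasoning

module Wrapping {o ℓ e : Level} (𝒟 : Duploid o ℓ e) where
  open Duploid 𝒟
  open _⊣_ ⇓⊣id
  private
    module ⇓ = _⇀_ ⇓
    module 𝒫 = Category (𝒫ₜ 𝒟)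

  wrap : ∀ {A} → A ⇒ ⇓.F₀ A
  wrap = ♯ id

  unwrap : ∀ {A} → ⇓.F₀ A ⇒ A
  unwrap = Inverse.from (φ _ _) id

  -- The right adjoint is the identity, so naturality in the codomain turns transposition into
  -- precomposition with the unit `wrap`.
  ♯-wrap : ∀ {A B} (h : ⇓.F₀ A ⇒ B) → ♯ h ≈ h ∘ wrap
  ♯-wrap h = ≈.trans (♯-cong (≈.sym (identityʳ h))) (naturalʳ h id)

  ♯-∘-unwrap : ∀ {A B} (g : A ⇒ B) → ♯ (g ∘ unwrap) ≈ g
  ♯-∘-unwrap g = begin
    ♯ (g ∘ unwrap)  ≈⟨ naturalʳ g unwrap ⟩
    g ∘ ♯ unwrap    ≈⟨ ∘-congˡ (Inverse.strictlyInverseˡ (φ _ _) id) ⟩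
    g ∘ id          ≈⟨ identityʳ g ⟩
    g               ∎
    where open SetoidReasoning (hom _ _)

  unwrap∘wrap : ∀ {A} → unwrap ∘ wrap ≈ id {A}
  unwrap∘wrap =
    ≈.trans (≈.sym (♯-wrap unwrap)) (Inverse.strictlyInverseˡ (φ _ _) id)

  wrap∘unwrap : ∀ {A} → wrap ∘ unwrap ≈ id {⇓.F₀ A}
  -- Both sides have transpose `wrap`, which is `♯ id` by definition.
  wrap∘unwrap = ♯-injective (♯-∘-unwrap wrap)

  -- Once `♯` is read as precomposition with `wrap`, this is exactly `naturalʳ`.
  wrap-thunkable : ∀ {A} → Thunkable (wrap {A})
  wrap-thunkable g h = begin
    (h ∘ g) ∘ wrap  ≈⟨ ♯-wrap (h ∘ g) ⟨
    ♯ (h ∘ g)       ≈⟨ naturalʳ h g ⟩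
    h ∘ ♯ g         ≈⟨ ∘-congˡ (♯-wrap g) ⟩
    h ∘ (g ∘ wrap)  ∎
    where open SetoidReasoning (hom _ _)

  unwrap-linear : ∀ {A} → Linear (unwrap {A})
  unwrap-linear {A} = ⇓-positive A unwrap

  -- Both composites have transpose `g`.
  unwrap-natural : ∀ {A B} (g : A ⇒ B) → unwrap ∘ ⇓.F₁ g ≈ g ∘ unwrap
  unwrap-natural g = ♯-injective (begin
    ♯ (unwrap ∘ ⇓.F₁ g)  ≈⟨ naturalˡ unwrap g ⟩
    ♯ unwrap ∘ g         ≈⟨ ∘-congʳ (Inverse.strictlyInverseˡ (φ _ _) id) ⟩
    id ∘ g               ≈⟨ identityˡ g ⟩
    g                    ≈⟨ ♯-∘-unwrap g ⟨
    ♯ (g ∘ unwrap)       ∎)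
    where open SetoidReasoning (hom _ _)

  unwrapping : ∀ P {N} → Negative N →
               Inverse (𝒫.hom P (⇓.F₀ N , ⇓-positive N)) (hom (proj₁ P) N)
  unwrapping P N-neg = record
    { to        = λ (h , _) → unwrap ∘ h
    ; from      = λ f → wrap ∘ f , thunkable-∘ wrap-thunkable (N-neg f)
    ; to-cong   = ∘-congˡ
    ; from-cong = ∘-congˡ
    ; inverse   =
        (λ {f} p → ≈.trans (∘-congˡ p) (cancel (N-neg f) unwrap∘wrap))
      , (λ {(_ , h-th)} p → ≈.trans (∘-congˡ p) (cancel h-th wrap∘unwrap))
    }
    where
      -- Thunkability of the innermost factor permits the rebracketing. In one round trip it comes
      -- from the negativity of `N`, in the other from the proof carried by a morphism of `𝒫ₜ`.
      cancel : ∀ {A B C} {k : C ⇒ B} {g : B ⇒ C} {f : A ⇒ B} →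
               Thunkable f → k ∘ g ≈ id → k ∘ (g ∘ f) ≈ f
      cancel {f = f} f-th kg≈id = ≈.trans (≈.sym (f-th _ _))
        (≈.trans (∘-congʳ kg≈id) (identityˡ f))

proposition34 : ∀ {o ℓ e o′ ℓ′ e′} (𝒟 : Duploid o ℓ e) (𝒞 : Category o′ ℓ′ e′)
    (F : Category.nonAssocCategory 𝒞 ⇀ Duploid.nonAssocCategory 𝒟)
    (G : Duploid.nonAssocCategory 𝒟 ⇀ Category.nonAssocCategory 𝒞)
    (F⊣G : F ⊣ G) (F⊣G-positive : _⊣_.IsPositive F⊣G) →
    RelativeCoadjunction (⇓ₗ 𝒟) (corestrictₜ 𝒟 𝒞 F⊣G F⊣G-positive) (restrictₗ 𝒟 𝒞 F⊣G)
proposition34 𝒟 𝒞 F G F⊣G F⊣G-positive = record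
  { ψ        = λ C (N , N-neg) →
      -- Here `φ` and `♯` belong to `F⊣G`, whereas inside `Wrapping` they belong to `⇓⊣id`.
      Composition.inverse (unwrapping (F.F₀ C , F⊣G-positive C) N-neg) (φ C N)
  ; naturalᴮ = λ (g , g-lin) (h , h-th) → begin
      -- Moving `g` outwards takes two rebracketings: the first by thunkability of `h`, the second
      -- by linearity of `g`.
      ♯ (unwrap 𝒟.∘ (⇓.F₁ g 𝒟.∘ h))  ≈⟨ ♯-cong (h-th (⇓.F₁ g) unwrap) ⟨
      ♯ ((unwrap 𝒟.∘ ⇓.F₁ g) 𝒟.∘ h)  ≈⟨ ♯-cong (𝒟.∘-congʳ (unwrap-natural g)) ⟩
      ♯ ((g 𝒟.∘ unwrap) 𝒟.∘ h)       ≈⟨ ♯-cong (g-lin h unwrap) ⟩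
      ♯ (g 𝒟.∘ (unwrap 𝒟.∘ h))       ≈⟨ naturalʳ g (unwrap 𝒟.∘ h) ⟩
      G.F₁ g 𝒞.∘ ♯ (unwrap 𝒟.∘ h)    ∎
  ; naturalᶜ = λ (h , _) f → begin
      -- `unwrap` is linear because its source `⇓ N` is positive.
      ♯ (unwrap 𝒟.∘ (h 𝒟.∘ F.F₁ f))  ≈⟨ ♯-cong (unwrap-linear (F.F₁ f) h) ⟨
      ♯ ((unwrap 𝒟.∘ h) 𝒟.∘ F.F₁ f)  ≈⟨ naturalˡ (unwrap 𝒟.∘ h) f ⟩
      ♯ (unwrap 𝒟.∘ h) 𝒞.∘ f         ∎
  }
  where
    module 𝒟 = Duploid 𝒟
    module 𝒞 = Category 𝒞
    module F = _⇀_ F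
    module G = _⇀_ G
    module ⇓ = _⇀_ 𝒟.⇓
    open _⊣_ F⊣G
    open Wrapping 𝒟
    open module Reasoning {A B} = SetoidReasoning (𝒞.hom A B)
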